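{- Let $k\ge 2$. For every $n\ge 2k$ there are weighted $k$-uniform hypergraphs $w_1,\ldots,w_k:[n]^{(k)}\to\mathbb{R}$ such that, for every $i$, $w_i([n])=0$ and $\|w_i\|_1=\binom nk$, and such that for all $1\le i<j\le k$ we have $$\operatorname{disc}(w_i,w_j)=0.$$
   Context: $[n]=\{1,\ldots,n\}$ and $V^{(k)}$ denotes the family of $k$-element subsets of $V$. A weighted $k$-uniform hypergraph on $V$ is a function $w:V^{(k)}\to\mathbb{R}$; $w(S)=\sum_{e\in S^{(k)}}w(e)$ for $S\subseteq V$, $\|w\|_1=\sum_{e}|w(e)|$, $\langle w,u\rangle=\sum_{e\in V^{(k)}}w(e)u(e)$, and the density is $d(w)=w(V)/\binom{|V|}{k}$. For a permutation $\pi$ of $V$, $w_\pi(e)=w(\pi^{ -1}(e))$. With $n=|V|$, $\operatorname{disc}^+(w,u)=\max_\pi\langle w_\pi,u\rangle-d(w)d(u)\binom nk$, $\operatorname{disc}^-(w,u)=d(w)d(u)\binom nk-\min_\pi\langle w_\pi,u\rangle$ (maxima/minima over all permutations $\pi$ of $V$), and $\operatorname{disc}(w,u)=\max\{\operatorname{disc}^+(w,u),\operatorname{disc}^-(w,u)\}=\max_\pi|\langle w_\pi,u\rangle-d(w)d(u)\binom nk|$. -}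

module Defs where

open import Data.Bool using (if_then_else_)
open import Data.Empty using (⊥)
open import Data.Empty.Irrelevant using (⊥-elim)
open import Data.Fin using (Fin; zero; suc; punchIn)
open import Data.Fin.Permutation as Perm using (Permutation′; _⟨$⟩ʳ_; _⟨$⟩ˡ_)
open import Data.Fin.Subset using (Subset; inside; outside; ⊤; ∣_∣)
open import Data.Fin.Subset.Properties using (_⊆?_)
open import Data.Integer using (+_)
open import Data.Irrelevant as Irr using ([_])
open import Data.List as List using (List; []; _∷_; _++_; filter; allFin; concatMap)
open import Data.List.Membership.Propositional using (_∈_)
open import Data.List.Membership.Propositional.Properties
  using (∈-map⁺; ∈-map⁻; ∈-++⁺ˡ; ∈-++⁺ʳ; ∈-allFin)
open import Data.List.Relation.Unary.All using ([])
open import Data.List.Relation.Unary.AllPairs using ([]; _∷_)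
open import Data.List.Relation.Unary.Any as Any using (Any; here)
import Data.List.Relation.Unary.Any.Properties as Any
open import Data.List.Relation.Unary.Unique.Propositional using (Unique)
import Data.List.Relation.Unary.Unique.Propositional.Properties as Unique
open import Data.Nat as ℕ using (ℕ; zero; suc; NonZero)
open import Data.Nat.Combinatorics using (_C_; nCk+nC[k+1]≡[n+1]C[k+1])
import Data.Nat.Properties as ℕ
open import Data.Product using (∃-syntax; _×_; _,_; proj₁; proj₂)
open import Data.Rational as ℚ using (ℚ; 0ℚ; 1ℚ; Positive)
import Data.Rational.Properties as ℚ
open import Data.Rational.Solver using (module +-*-Solver)
open import Data.Refinement using (Refinement-syntax; Refinement; _,_; value)
open import Data.Sum using (inj₁; inj₂)
open import Data.Vec using ([]; _∷_; lookup; tabulate)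
import Data.Vec.Properties as Vec
open import Algebra.Properties.CommutativeMonoid.Sum ℕ.+-0-commutativeMonoid
  using (sum; sum-permute; sum-cong-≗)
open import Relation.Binary.PropositionalEquality
  using (_≡_; refl; sym; trans; cong; cong₂; subst; subst₂)

-- The reals are Cauchy sequences of rationals.  The carrier is not quotiented:
-- equality of reals is the relation _≃_.
Cauchy : (ℕ → ℚ) → Set
Cauchy a = ∀ {ε} → 0ℚ ℚ.< ε →
  ∃[ N ] (∀ {m n} → N ℕ.≤ m → N ℕ.≤ n → ℚ.∣ a m ℚ.- a n ∣ ℚ.< ε)

record ℝ : Set where
  constructor mkℝ
  field
    seq    : ℕ → ℚ
    cauchy : Cauchy seq

open ℝ public

infix 4 _≃_

_≃_ : ℝ → ℝ → Set
x ≃ y = ∀ {ε} → 0ℚ ℚ.< ε →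
  ∃[ N ] (∀ {n} → N ℕ.≤ n → ℚ.∣ seq x n ℚ.- seq y n ∣ ℚ.< ε)

private

  triangle : ∀ a b → ℚ.∣ a ∣ ℚ.≤ ℚ.∣ b ∣ ℚ.+ ℚ.∣ a ℚ.- b ∣
  triangle a b = subst (λ c → ℚ.∣ c ∣ ℚ.≤ ℚ.∣ b ∣ ℚ.+ ℚ.∣ a ℚ.- b ∣)
    (solve 2 (λ a b → b :+ (a :- b) := a) refl a b)
    (ℚ.∣p+q∣≤∣p∣+∣q∣ b (a ℚ.- b))
    where open +-*-Solver

  ∣a-b∣≡∣b-a∣ : ∀ a b → ℚ.∣ a ℚ.- b ∣ ≡ ℚ.∣ b ℚ.- a ∣
  ∣a-b∣≡∣b-a∣ a b = trans
    (cong ℚ.∣_∣ (solve 2 (λ a b → a :- b := :- (b :- a)) refl a b))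
    (ℚ.∣-p∣≡∣p∣ (b ℚ.- a))
    where open +-*-Solver

  a≤∣a∣ : ∀ a → a ℚ.≤ ℚ.∣ a ∣
  a≤∣a∣ a with ℚ.≤-total 0ℚ a
  ... | inj₁ 0≤a = ℚ.≤-reflexive (sym (ℚ.0≤p⇒∣p∣≡p 0≤a))
  ... | inj₂ a≤0 = ℚ.≤-trans a≤0 (ℚ.0≤∣p∣ a)

  a≤b+∣a-b∣ : ∀ a b → a ℚ.≤ b ℚ.+ ℚ.∣ a ℚ.- b ∣
  a≤b+∣a-b∣ a b = subst (ℚ._≤ b ℚ.+ ℚ.∣ a ℚ.- b ∣)
    (solve 2 (λ a b → b :+ (a :- b) := a) refl a b)
    (ℚ.+-monoʳ-≤ b (a≤∣a∣ (a ℚ.- b)))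
    where open +-*-Solver

  ∣e∣≤∣e∣+∣f∣ : ∀ e f → ℚ.∣ e ∣ ℚ.≤ ℚ.∣ e ∣ ℚ.+ ℚ.∣ f ∣
  ∣e∣≤∣e∣+∣f∣ e f = subst (ℚ._≤ ℚ.∣ e ∣ ℚ.+ ℚ.∣ f ∣) (ℚ.+-identityʳ ℚ.∣ e ∣)
    (ℚ.+-monoʳ-≤ ℚ.∣ e ∣ (ℚ.0≤∣p∣ f))

  ∣f∣≤∣e∣+∣f∣ : ∀ e f → ℚ.∣ f ∣ ℚ.≤ ℚ.∣ e ∣ ℚ.+ ℚ.∣ f ∣
  ∣f∣≤∣e∣+∣f∣ e f = subst (ℚ._≤ ℚ.∣ e ∣ ℚ.+ ℚ.∣ f ∣) (ℚ.+-identityˡ ℚ.∣ f ∣)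
    (ℚ.+-monoˡ-≤ ℚ.∣ f ∣ (ℚ.0≤∣p∣ e))

  dist≤ : ∀ {x y e} → x ℚ.≤ y ℚ.+ e → y ℚ.≤ x ℚ.+ e → ℚ.∣ x ℚ.- y ∣ ℚ.≤ e
  dist≤ {x} {y} {e} x≤y+e y≤x+e with ℚ.∣p∣≡p∨∣p∣≡-p (x ℚ.- y)
  ... | inj₁ eq rewrite eq = subst (x ℚ.- y ℚ.≤_)
    (solve 2 (λ y e → y :+ e :- y := e) refl y e)
    (ℚ.+-monoˡ-≤ (ℚ.- y) x≤y+e)
    where open +-*-Solver
  ... | inj₂ eq rewrite eq = subst₂ ℚ._≤_
    (solve 2 (λ x y → y :- x := :- (x :- y)) refl x y)
    (solve 2 (λ x e → x :+ e :- x := e) refl x e)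
    (ℚ.+-monoˡ-≤ (ℚ.- x) y≤x+e)
    where open +-*-Solver

  lipschitz₂ : (f : ℚ → ℚ → ℚ) →
    (∀ a b c d → f a b ℚ.≤ f c d ℚ.+ (ℚ.∣ a ℚ.- c ∣ ℚ.+ ℚ.∣ b ℚ.- d ∣)) →
    ∀ a b c d → ℚ.∣ f a b ℚ.- f c d ∣ ℚ.≤ ℚ.∣ a ℚ.- c ∣ ℚ.+ ℚ.∣ b ℚ.- d ∣
  lipschitz₂ f f≤ a b c d = dist≤ (f≤ a b c d)
    (subst (λ e → f c d ℚ.≤ f a b ℚ.+ e)
      (cong₂ ℚ._+_ (∣a-b∣≡∣b-a∣ c a) (∣a-b∣≡∣b-a∣ d b)) (f≤ c d a b))

  ⊔-lip : ∀ a b c d →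
    (a ℚ.⊔ b) ℚ.≤ (c ℚ.⊔ d) ℚ.+ (ℚ.∣ a ℚ.- c ∣ ℚ.+ ℚ.∣ b ℚ.- d ∣)
  ⊔-lip a b c d = ℚ.⊔-lub
    (ℚ.≤-trans (a≤b+∣a-b∣ a c) (ℚ.+-mono-≤ (ℚ.p≤p⊔q c d)
      (∣e∣≤∣e∣+∣f∣ (a ℚ.- c) (b ℚ.- d))))
    (ℚ.≤-trans (a≤b+∣a-b∣ b d) (ℚ.+-mono-≤ (ℚ.p≤q⊔p c d)
      (∣f∣≤∣e∣+∣f∣ (a ℚ.- c) (b ℚ.- d))))

  ⊓-lip : ∀ a b c d →
    (a ℚ.⊓ b) ℚ.≤ (c ℚ.⊓ d) ℚ.+ (ℚ.∣ a ℚ.- c ∣ ℚ.+ ℚ.∣ b ℚ.- d ∣)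
  ⊓-lip a b c d with ℚ.⊓-sel c d
  ... | inj₁ eq rewrite eq = ℚ.≤-trans (ℚ.p⊓q≤p a b) (ℚ.≤-trans (a≤b+∣a-b∣ a c)
    (ℚ.+-monoʳ-≤ c (∣e∣≤∣e∣+∣f∣ (a ℚ.- c) (b ℚ.- d))))
  ... | inj₂ eq rewrite eq = ℚ.≤-trans (ℚ.p⊓q≤q a b) (ℚ.≤-trans (a≤b+∣a-b∣ b d)
    (ℚ.+-monoʳ-≤ d (∣f∣≤∣e∣+∣f∣ (a ℚ.- c) (b ℚ.- d))))

  +-lip : ∀ a b c d → ℚ.∣ (a ℚ.+ b) ℚ.- (c ℚ.+ d) ∣ ℚ.≤ ℚ.∣ a ℚ.- c ∣ ℚ.+ ℚ.∣ b ℚ.- d ∣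
  +-lip a b c d = subst (λ e → ℚ.∣ e ∣ ℚ.≤ ℚ.∣ a ℚ.- c ∣ ℚ.+ ℚ.∣ b ℚ.- d ∣)
    (solve 4 (λ a b c d → (a :- c) :+ (b :- d) := (a :+ b) :- (c :+ d)) refl a b c d)
    (ℚ.∣p+q∣≤∣p∣+∣q∣ (a ℚ.- c) (b ℚ.- d))
    where open +-*-Solver

  *-lip : ∀ a b c d → ℚ.∣ (a ℚ.* b) ℚ.- (c ℚ.* d) ∣ ℚ.≤
                      ℚ.∣ d ∣ ℚ.* ℚ.∣ a ℚ.- c ∣ ℚ.+ ℚ.∣ a ∣ ℚ.* ℚ.∣ b ℚ.- d ∣
  *-lip a b c d = subst₂ ℚ._≤_
    (cong ℚ.∣_∣ (solve 4 (λ a b c d → d :* (a :- c) :+ a :* (b :- d) := a :* b :- c :* d)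
      refl a b c d))
    (cong₂ ℚ._+_ (ℚ.∣p*q∣≡∣p∣*∣q∣ d (a ℚ.- c)) (ℚ.∣p*q∣≡∣p∣*∣q∣ a (b ℚ.- d)))
    (ℚ.∣p+q∣≤∣p∣+∣q∣ (d ℚ.* (a ℚ.- c)) (a ℚ.* (b ℚ.- d)))
    where open +-*-Solver

  -- If the oscillation of h is eventually at most A times that of x plus B
  -- times that of y, then h is Cauchy: at tolerance ε, use ε / (A + B) for
  -- x and for y.
  combine : (x y : ℝ) (h : ℕ → ℚ) (A B : ℚ) .{{_ : Positive A}} .{{_ : Positive B}}
    (N₀ : ℕ) →
    (∀ {m n} → N₀ ℕ.≤ m → N₀ ℕ.≤ n → ℚ.∣ h m ℚ.- h n ∣ ℚ.≤
      A ℚ.* ℚ.∣ seq x m ℚ.- seq x n ∣ ℚ.+ B ℚ.* ℚ.∣ seq y m ℚ.- seq y n ∣) →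
    Cauchy h
  combine x y h A B N₀ h≤ {ε} 0<ε = N₀ ℕ.+ (M ℕ.+ N) , λ {m} {n} p q →
    ℚ.≤-<-trans
      (h≤ (ℕ.≤-trans (ℕ.m≤m+n N₀ _) p) (ℕ.≤-trans (ℕ.m≤m+n N₀ _) q))
      (subst (_ ℚ.<_) total (ℚ.+-mono-<
        (ℚ.*-monoʳ-<-pos A (x-close (ℕ.≤-trans M≤ p) (ℕ.≤-trans M≤ q)))
        (ℚ.*-monoʳ-<-pos B (y-close (ℕ.≤-trans N≤ p) (ℕ.≤-trans N≤ q)))))
    where
    instance
      A+B>0 : Positive (A ℚ.+ B)
      A+B>0 = ℚ.pos+pos⇒pos A B
      A+B≢0 : ℚ.NonZero (A ℚ.+ B)
      A+B≢0 = ℚ.pos⇒nonZero (A ℚ.+ B)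
    r δ : ℚ
    r = ℚ.1/ (A ℚ.+ B)
    δ = r ℚ.* ε
    0<δ : 0ℚ ℚ.< δ
    0<δ = ℚ.positive⁻¹ δ
      {{ℚ.pos*pos⇒pos r {{ℚ.1/pos⇒pos (A ℚ.+ B)}} ε {{ℚ.positive 0<ε}}}}
    total : A ℚ.* δ ℚ.+ B ℚ.* δ ≡ ε
    total = trans
      (solve 4 (λ A B r ε → A :* (r :* ε) :+ B :* (r :* ε) := ((A :+ B) :* r) :* ε)
        refl A B r ε)
      (trans (cong (ℚ._* ε) (ℚ.*-inverseʳ (A ℚ.+ B))) (ℚ.*-identityˡ ε))
      where open +-*-Solver
    M N : ℕ
    M = cauchy x 0<δ .proj₁
    N = cauchy y 0<δ .proj₁
    x-close : ∀ {m n} → M ℕ.≤ m → M ℕ.≤ n → ℚ.∣ seq x m ℚ.- seq x n ∣ ℚ.< δ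
    x-close = cauchy x 0<δ .proj₂
    y-close : ∀ {m n} → N ℕ.≤ m → N ℕ.≤ n → ℚ.∣ seq y m ℚ.- seq y n ∣ ℚ.< δ
    y-close = cauchy y 0<δ .proj₂
    M≤ : M ℕ.≤ N₀ ℕ.+ (M ℕ.+ N)
    M≤ = ℕ.≤-trans (ℕ.m≤m+n M N) (ℕ.m≤n+m _ N₀)
    N≤ : N ℕ.≤ N₀ ℕ.+ (M ℕ.+ N)
    N≤ = ℕ.≤-trans (ℕ.m≤n+m N M) (ℕ.m≤n+m _ N₀)

  combine₁ : (x y : ℝ) (f : ℚ → ℚ → ℚ) →
    (∀ a b c d → ℚ.∣ f a b ℚ.- f c d ∣ ℚ.≤ ℚ.∣ a ℚ.- c ∣ ℚ.+ ℚ.∣ b ℚ.- d ∣) →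
    Cauchy (λ n → f (seq x n) (seq y n))
  combine₁ x y f lip = combine x y (λ n → f (seq x n) (seq y n)) 1ℚ 1ℚ 0 λ {m} {n} _ _ →
    subst (ℚ.∣ f (seq x m) (seq y m) ℚ.- f (seq x n) (seq y n) ∣ ℚ.≤_)
      (sym (cong₂ ℚ._+_ (ℚ.*-identityˡ ℚ.∣ seq x m ℚ.- seq x n ∣)
                        (ℚ.*-identityˡ ℚ.∣ seq y m ℚ.- seq y n ∣)))
      (lip (seq x m) (seq y m) (seq x n) (seq y n))

  Bounded : ℝ → Set
  Bounded x = ∃[ B ] ∃[ N ]
    (0ℚ ℚ.< B × (∀ {n} → N ℕ.≤ n → ℚ.∣ seq x n ∣ ℚ.≤ B))

  bounded : (x : ℝ) → Bounded x
  bounded x with N , close ← cauchy x (ℚ.positive⁻¹ 1ℚ) =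
    ℚ.∣ seq x N ∣ ℚ.+ 1ℚ , N
    , ℚ.+-mono-≤-< (ℚ.0≤∣p∣ (seq x N)) (ℚ.positive⁻¹ 1ℚ)
    , λ {n} N≤n → ℚ.≤-trans (triangle (seq x n) (seq x N))
        (ℚ.+-monoʳ-≤ ℚ.∣ seq x N ∣ (ℚ.<⇒≤ (close N≤n ℕ.≤-refl)))

  *-cauchy : (x y : ℝ) → Cauchy (λ n → seq x n ℚ.* seq y n)
  *-cauchy x y = go (bounded x) (bounded y)
    where
    go : Bounded x → Bounded y → Cauchy (λ n → seq x n ℚ.* seq y n)
    go (A , M , 0<A , x≤A) (B , N , 0<B , y≤B) =
      combine x y (λ n → seq x n ℚ.* seq y n) B A {{ℚ.positive 0<B}} {{ℚ.positive 0<A}}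
        (M ℕ.+ N) λ {m} {n} p q →
        ℚ.≤-trans (*-lip (seq x m) (seq y m) (seq x n) (seq y n))
          (ℚ.+-mono-≤
            (ℚ.*-monoʳ-≤-nonNeg ℚ.∣ seq x m ℚ.- seq x n ∣
              {{ℚ.∣-∣-nonNeg (seq x m ℚ.- seq x n)}}
              (y≤B (ℕ.≤-trans (ℕ.m≤n+m N M) q)))
            (ℚ.*-monoʳ-≤-nonNeg ℚ.∣ seq y m ℚ.- seq y n ∣
              {{ℚ.∣-∣-nonNeg (seq y m ℚ.- seq y n)}}
              (x≤A (ℕ.≤-trans (ℕ.m≤m+n M N) p))))

fromℚ : ℚ → ℝ
fromℚ q = mkℝ (λ _ → q) λ 0<ε → 0 , λ _ _ →
  subst (ℚ._< _) (sym (cong ℚ.∣_∣ (ℚ.+-inverseʳ q))) 0<ε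

fromℕ : ℕ → ℝ
fromℕ m = fromℚ (+ m ℚ./ 1)

0ℝ : ℝ
0ℝ = fromℕ 0

infixl 6 _+_ _-_ _⊔_ _⊓_
infixl 7 _*_ _÷_
infix  8 -_

_+_ : ℝ → ℝ → ℝ
x + y = mkℝ (λ n → seq x n ℚ.+ seq y n) (combine₁ x y ℚ._+_ +-lip)

_*_ : ℝ → ℝ → ℝ
x * y = mkℝ (λ n → seq x n ℚ.* seq y n) (*-cauchy x y)

-_ : ℝ → ℝ
- x = mkℝ (λ n → ℚ.- seq x n) λ 0<ε →
  let N , close = cauchy x 0<ε in N , λ {m} {n} p q →
  subst (ℚ._< _) (trans (∣a-b∣≡∣b-a∣ (seq x m) (seq x n))
    (cong ℚ.∣_∣ (solve 2 (λ a b → b :- a := (:- a) :- (:- b)) refl (seq x m) (seq x n))))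
    (close p q)
  where open +-*-Solver

_-_ : ℝ → ℝ → ℝ
x - y = x + - y

_÷_ : ℝ → (m : ℕ) .{{_ : NonZero m}} → ℝ
x ÷ m = x * fromℚ (+ 1 ℚ./ m)

_⊔_ : ℝ → ℝ → ℝ
x ⊔ y = mkℝ (λ n → seq x n ℚ.⊔ seq y n) (combine₁ x y ℚ._⊔_ (lipschitz₂ ℚ._⊔_ ⊔-lip))

_⊓_ : ℝ → ℝ → ℝ
x ⊓ y = mkℝ (λ n → seq x n ℚ.⊓ seq y n) (combine₁ x y ℚ._⊓_ (lipschitz₂ ℚ._⊓_ ⊓-lip))

abs : ℝ → ℝ
abs x = mkℝ (λ n → ℚ.∣ seq x n ∣) λ 0<ε →
  let N , close = cauchy x 0<ε in N , λ {m} {n} p q →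
  ℚ.≤-<-trans
    (dist≤ (triangle (seq x m) (seq x n))
      (subst (λ e → ℚ.∣ seq x n ∣ ℚ.≤ ℚ.∣ seq x m ∣ ℚ.+ e) (∣a-b∣≡∣b-a∣ (seq x n) (seq x m))
        (triangle (seq x n) (seq x m))))
    (close p q)

∑ : {A : Set} → List A → (A → ℝ) → ℝ
∑ xs f = List.foldr (λ x s → f x + s) 0ℝ xs

-- The size proof is irrelevant, so two edges
-- with the same vertices are equal.
Edge : ℕ → ℕ → Set
Edge n k = [ e ∈ Subset n ∣ ∣ e ∣ ≡ k ]

cons-in : ∀ {n k} → Edge n k → Edge (suc n) (suc k)
cons-in (e , p) = inside ∷ e , Irr.map (cong suc) p

cons-out : ∀ {n k} → Edge n k → Edge (suc n) k
cons-out (e , p) = outside ∷ e , p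

edges : ∀ n k → List (Edge n k)
edges zero    zero    = ([] , [ refl ]) ∷ []
edges zero    (suc k) = []
edges (suc n) zero    = List.map cons-out (edges n zero)
edges (suc n) (suc k) = List.map cons-in (edges n k) ++ List.map cons-out (edges n (suc k))

∈-edges : ∀ {n k} (e : Edge n k) → e ∈ edges n k
∈-edges {zero}  {zero}  ([] , _)            = here refl
∈-edges {zero}  {suc k} ([] , [ p ])        = ⊥-elim (ℕ.0≢1+n p)
∈-edges {suc n} {zero}  (inside  ∷ e , [ p ]) = ⊥-elim (ℕ.1+n≢0 p)
∈-edges {suc n} {zero}  (outside ∷ e , p)   = ∈-map⁺ cons-out (∈-edges (e , p))
∈-edges {suc n} {suc k} (inside  ∷ e , [ p ]) =
  ∈-++⁺ˡ (∈-map⁺ cons-in (∈-edges (e , [ ℕ.suc-injective p ])))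
∈-edges {suc n} {suc k} (outside ∷ e , p)   =
  ∈-++⁺ʳ (List.map cons-in (edges n k)) (∈-map⁺ cons-out (∈-edges (e , p)))

edges-unique : ∀ n k → Unique (edges n k)
edges-unique zero    zero    = [] ∷ []
edges-unique zero    (suc k) = []
edges-unique (suc n) zero    = Unique.map⁺ (λ { refl → refl }) (edges-unique n zero)
edges-unique (suc n) (suc k) = Unique.++⁺
  (Unique.map⁺ (λ { refl → refl }) (edges-unique n k))
  (Unique.map⁺ (λ { refl → refl }) (edges-unique n (suc k)))
  λ (p , q) → disjoint (∈-map⁻ cons-in p) (∈-map⁻ cons-out q)
  where
  disjoint : ∀ {e} → ∃[ x ] (x ∈ edges n k × e ≡ cons-in x) →
             ∃[ y ] (y ∈ edges n (suc k) × e ≡ cons-out y) → ⊥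
  disjoint (_ , _ , refl) (_ , _ , ())

nCk-nonZero : ∀ {n k} → k ℕ.≤ n → NonZero (n C k)
nCk-nonZero {n}     {zero}  _          = _
nCk-nonZero {suc n} {suc k} (ℕ.s≤s k≤n) = ℕ.>-nonZero (subst (0 ℕ.<_)
  (nCk+nC[k+1]≡[n+1]C[k+1] n k)
  (ℕ.<-≤-trans (ℕ.>-nonZero⁻¹ (n C k) {{nCk-nonZero k≤n}}) (ℕ.m≤m+n (n C k) (n C suc k))))

permutations : ∀ n → List (Permutation′ n)
permutations zero    = Perm.id ∷ []
permutations (suc n) =
  concatMap (λ j → List.map (Perm.insert zero j) (permutations n)) (allFin (suc n))

∈-permutations : ∀ {n} (π : Permutation′ n) → Any (Perm._≈ π) (permutations n)
∈-permutations {zero}  π = here λ ()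
∈-permutations {suc n} π =
  Any.concatMap⁺ _ (Any.map (λ { refl → Any.map⁺ (Any.map extend (∈-permutations π′)) })
    (∈-allFin (π ⟨$⟩ʳ zero)))
  where
  π′ : Permutation′ n
  π′ = Perm.remove zero π
  extend : ∀ {ρ} → ρ Perm.≈ π′ → Perm.insert zero (π ⟨$⟩ʳ zero) ρ Perm.≈ π
  extend {ρ} ρ≈ zero    = refl
  extend {ρ} ρ≈ (suc i) =
    trans (Perm.insert-punchIn zero (π ⟨$⟩ʳ zero) ρ i)
      (trans (cong (punchIn (π ⟨$⟩ʳ zero)) (ρ≈ i))
        (sym (Perm.punchIn-permute π zero i)))

-- Folding from the value at the identity, which is itself a permutation,
-- avoids a separate non-emptiness argument.
maxₚ minₚ : ∀ {n} → (Permutation′ n → ℝ) → ℝ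
maxₚ {n} f = List.foldr (λ π m → f π ⊔ m) (f Perm.id) (permutations n)
minₚ {n} f = List.foldr (λ π m → f π ⊓ m) (f Perm.id) (permutations n)

-- π(S) = { π(x) : x ∈ S }, i.e. y ∈ π(S) iff π⁻¹(y) ∈ S.
image : ∀ {n} → Permutation′ n → Subset n → Subset n
image π S = tabulate λ y → lookup S (π ⟨$⟩ˡ y)

private
  indicator : ∀ {n} → Subset n → Fin n → ℕ
  indicator S i = if lookup S i then 1 else 0

  ∣S∣≡sum : ∀ {n} (S : Subset n) → ∣ S ∣ ≡ sum (indicator S)
  ∣S∣≡sum []            = refl
  ∣S∣≡sum (inside  ∷ S) = cong suc (∣S∣≡sum S)
  ∣S∣≡sum (outside ∷ S) = ∣S∣≡sum S

∣image∣ : ∀ {n} (π : Permutation′ n) (S : Subset n) → ∣ image π S ∣ ≡ ∣ S ∣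
∣image∣ π S = trans (∣S∣≡sum (image π S)) (trans
  (sum-cong-≗ {x = indicator (image π S)} {y = λ y → indicator S (π ⟨$⟩ˡ y)} λ y →
    cong (λ b → if b then 1 else 0) (Vec.lookup∘tabulate (λ y → lookup S (π ⟨$⟩ˡ y)) y))
  (trans (sym (sum-permute (indicator S) (Perm.flip π))) (sym (∣S∣≡sum S))))

imageᵉ : ∀ {n k} → Permutation′ n → Edge n k → Edge n k
imageᵉ π (e , [ p ]) = image π e , [ trans (∣image∣ π e) p ]

WeightedHypergraph : ℕ → ℕ → Set
WeightedHypergraph n k = Edge n k → ℝ

module _ {n k : ℕ} where

  weight : WeightedHypergraph n k → Subset n → ℝ
  weight w S = ∑ (filter (λ e → value e ⊆? S) (edges n k)) w

  ‖_‖₁ : WeightedHypergraph n k → ℝ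
  ‖ w ‖₁ = ∑ (edges n k) λ e → abs (w e)

  ⟨_,_⟩ : WeightedHypergraph n k → WeightedHypergraph n k → ℝ
  ⟨ w , u ⟩ = ∑ (edges n k) λ e → w e * u e

  permute : Permutation′ n → WeightedHypergraph n k → WeightedHypergraph n k
  permute π w e = w (imageᵉ (Perm.flip π) e)

  module _ .{{_ : NonZero (n C k)}} where

    density : WeightedHypergraph n k → ℝ
    density w = weight w ⊤ ÷ (n C k)

    disc⁺ disc⁻ disc : WeightedHypergraph n k → WeightedHypergraph n k → ℝ
    disc⁺ w u = maxₚ (λ π → ⟨ permute π w , u ⟩) - density w * density u * fromℕ (n C k)
    disc⁻ w u = density w * density u * fromℕ (n C k) - minₚ (λ π → ⟨ permute π w , u ⟩)
    disc  w u = disc⁺ w u ⊔ disc⁻ w u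

{-# OPTIONS --safe #-}
-- For disjoint pairs {a_t , b_t}, t < j, put U_j(e) = ∏_{t<j} ([a_t ∈ e] − [b_t ∈ e]);
-- this function lies in the j-th irreducible S_n-component of the functions on
-- k-sets, and normalising it gives the hypergraphs.  Orthogonality needs no
-- representation theory: a permuted U_i expands into signed monomials
-- ∏_{v∈B} [v ∈ e] with |B| ≤ i < j, so B misses some pair {a_t , b_t}, and swapping
-- a_t with b_t fixes the monomial while negating U_j.
module Submission where

open import Data.Fin using (Fin; _<_)
open import Data.Fin.Subset using (⊤)
open import Data.Nat using (ℕ; _≤_; _*_)
open import Data.Nat.Combinatorics using (_C_)
open import Data.Nat.Properties using (≤-trans; m≤m+n)
open import Data.Product using (Σ-syntax; _×_)
open import Defs using (WeightedHypergraph; weight; ‖_‖₁; disc; _≃_; 0ℝ; fromℕ; nCk-nonZero)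

open import Data.Bool using (if_then_else_)
open import Data.Fin using (zero; suc; toℕ; inject≤; combine; punchIn)
open import Data.Fin.Permutation as Perm using (Permutation′; _⟨$⟩ʳ_; _⟨$⟩ˡ_)
import Data.Fin.Permutation.Components as PC
import Data.Fin.Properties as Fin
open import Data.Fin.Subset using (outside; ⊥)
open import Data.Fin.Subset.Properties using (_⊆?_; ⊆⊤; ∣⊥∣≡0)
open import Data.Integer using (+_)
open import Data.Irrelevant using ([_])
open import Data.List using (List; []; _∷_; foldr; map)
open import Data.List.Membership.Propositional using (_∈_)
open import Data.List.Membership.Propositional.Properties using (∈-map⁺)
open import Data.List.Membership.Propositional.Properties.WithK using (unique∧set⇒bag)
open import Data.List.Properties using (filter-all; foldr-map)
open import Data.List.Relation.Binary.BagAndSetEquality using (∼bag⇒↭)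
open import Data.List.Relation.Binary.Permutation.Propositional using (_↭_; ↭⇒↭ₛ)
import Data.List.Relation.Binary.Permutation.Propositional.Properties as ↭
import Data.List.Relation.Binary.Permutation.Setoid.Properties as ↭ₛ
import Data.List.Relation.Unary.All as All
open import Data.List.Relation.Unary.Any using (here; there)
import Data.List.Relation.Unary.Unique.Propositional.Properties as Unique
open import Data.Nat as ℕ using (zero; suc; NonZero; z≤n; s≤s; s≤s⁻¹)
import Data.Nat.Properties as ℕ
open import Data.Product using (∃; ∃-syntax; _,_; proj₁; proj₂)
open import Data.Rational as ℚ using (ℚ; 0ℚ; 1ℚ)
import Data.Rational.Properties as ℚ
open import Data.Rational.Solver using (module +-*-Solver)
open import Data.Refinement using (_,_; value)
open import Data.Vec using (lookup)
import Data.Vec.Functional as VecF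
import Data.Vec.Properties as Vec
open import Algebra.Properties.CommutativeMonoid.Sum ℚ.*-1-commutativeMonoid
  using () renaming (sum to ∏; sum-remove to ∏-remove; sum-cong-≗ to ∏-cong)
open import Function using (_∘_; mk⇔)
open import Relation.Binary.PropositionalEquality
open import Relation.Nullary using (¬_; yes; no)
open import Relation.Nullary.Decidable using (dec-true; dec-false)
open import Defs hiding (_+_; _*_; -_; _-_; _⊔_; _⊓_)

-- Reduction from reals to rationals

≗⇒≃ : ∀ x y → (∀ m → seq x m ≡ seq y m) → x ≃ y
-- All reals of the construction are constant sequences, so exact equality of terms is available and
-- index `0` serves every `ε`.
≗⇒≃ x y x≗y {ε} 0<ε = 0 , λ {m} _ → subst (ℚ._< ε)
  (sym (trans (cong (λ z → ℚ.∣ z ℚ.- seq y m ∣) (x≗y m)) (cong ℚ.∣_∣ (ℚ.+-inverseʳ (seq y m)))))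
  0<ε

p≡-p⇒p≡0 : ∀ {p} → p ≡ ℚ.- p → p ≡ 0ℚ
p≡-p⇒p≡0 {p} p≡-p = begin
  p                      ≡⟨ solve 1 (λ p → p := con ℚ.½ :* (p :+ p)) refl p ⟩
  ℚ.½ ℚ.* (p ℚ.+ p)      ≡⟨ cong (λ q → ℚ.½ ℚ.* (p ℚ.+ q)) p≡-p ⟩
  ℚ.½ ℚ.* (p ℚ.+ ℚ.- p)  ≡⟨ cong (ℚ.½ ℚ.*_) (ℚ.+-inverseʳ p) ⟩
  ℚ.½ ℚ.* 0ℚ             ≡⟨ ℚ.*-zeroʳ ℚ.½ ⟩
  0ℚ                     ∎
  where
  open ≡-Reasoning
  open +-*-Solver

-- Finite sums of rationals

∑ℚ : {A : Set} → List A → (A → ℚ) → ℚ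
∑ℚ xs f = foldr (λ x s → f x ℚ.+ s) 0ℚ xs

module _ {A : Set} where

  seq-∑ : ∀ (xs : List A) f m → seq (∑ xs f) m ≡ ∑ℚ xs (λ x → seq (f x) m)
  seq-∑ []       f m = refl
  seq-∑ (x ∷ xs) f m = cong (seq (f x) m ℚ.+_) (seq-∑ xs f m)

  ∑ℚ-cong : ∀ (xs : List A) {f g} → f ≗ g → ∑ℚ xs f ≡ ∑ℚ xs g
  ∑ℚ-cong []       f≗g = refl
  ∑ℚ-cong (x ∷ xs) f≗g = cong₂ ℚ._+_ (f≗g x) (∑ℚ-cong xs f≗g)

  ∑ℚ-- : ∀ (xs : List A) f g → ∑ℚ xs (λ x → f x ℚ.- g x) ≡ ∑ℚ xs f ℚ.- ∑ℚ xs g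
  ∑ℚ-- []       f g = refl
  ∑ℚ-- (x ∷ xs) f g = trans (cong (f x ℚ.- g x ℚ.+_) (∑ℚ-- xs f g))
    (solve 4 (λ a b s t → a :- b :+ (s :- t) := a :+ s :- (b :+ t)) refl
      (f x) (g x) (∑ℚ xs f) (∑ℚ xs g))
    where open +-*-Solver

  ∑ℚ-neg : ∀ (xs : List A) f → ∑ℚ xs (λ x → ℚ.- f x) ≡ ℚ.- ∑ℚ xs f
  ∑ℚ-neg []       f = refl
  ∑ℚ-neg (x ∷ xs) f = trans (cong (ℚ.- f x ℚ.+_) (∑ℚ-neg xs f))
    (sym (ℚ.neg-distrib-+ (f x) (∑ℚ xs f)))

  ∑ℚ-*ʳ : ∀ (xs : List A) f r → ∑ℚ xs (λ x → f x ℚ.* r) ≡ ∑ℚ xs f ℚ.* r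
  ∑ℚ-*ʳ []       f r = sym (ℚ.*-zeroˡ r)
  ∑ℚ-*ʳ (x ∷ xs) f r = trans (cong (f x ℚ.* r ℚ.+_) (∑ℚ-*ʳ xs f r))
    (sym (ℚ.*-distribʳ-+ r (f x) (∑ℚ xs f)))

  module _ {f : A → ℚ} (0≤f : ∀ x → 0ℚ ℚ.≤ f x) where

    0≤∑ℚ : ∀ xs → 0ℚ ℚ.≤ ∑ℚ xs f
    0≤∑ℚ []       = ℚ.≤-refl
    0≤∑ℚ (x ∷ xs) = ℚ.+-mono-≤ (0≤f x) (0≤∑ℚ xs)

    -- Used to bound an ℓ¹ norm from below by its value on a single edge.
    ∈⇒≤∑ℚ : ∀ {x xs} → x ∈ xs → f x ℚ.≤ ∑ℚ xs f
    ∈⇒≤∑ℚ {x} {y ∷ xs} (here refl) =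
      subst (ℚ._≤ ∑ℚ (y ∷ xs) f) (ℚ.+-identityʳ (f x)) (ℚ.+-monoʳ-≤ (f x) (0≤∑ℚ xs))
    ∈⇒≤∑ℚ {x} {y ∷ xs} (there x∈xs) =
      subst (ℚ._≤ ∑ℚ (y ∷ xs) f) (ℚ.+-identityˡ (f x)) (ℚ.+-mono-≤ (0≤f y) (∈⇒≤∑ℚ x∈xs))

  ∑ℚ-↭ : ∀ {xs ys : List A} f → xs ↭ ys → ∑ℚ xs f ≡ ∑ℚ ys f
  ∑ℚ-↭ {xs} {ys} f xs↭ys = begin
    ∑ℚ xs f                        ≡⟨ foldr-map ℚ._+_ f 0ℚ xs ⟨
    foldr ℚ._+_ 0ℚ (map f xs)      ≡⟨ ↭ₛ.foldr-commMonoid (setoid ℚ) ℚ.+-0-isCommutativeMonoid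
                                        (↭⇒↭ₛ (↭.map⁺ f xs↭ys)) ⟩
    foldr ℚ._+_ 0ℚ (map f ys)      ≡⟨ foldr-map ℚ._+_ f 0ℚ ys ⟩
    ∑ℚ ys f                        ∎
    where open ≡-Reasoning

-- Signed products and transpositions

∏-negate : ∀ {m} (f g : Fin m → ℚ) t → f t ≡ ℚ.- g t → (∀ s → s ≢ t → f s ≡ g s) →
           ∏ f ≡ ℚ.- ∏ g
∏-negate {suc m} f g t ft≡-gt f≡g = begin
  ∏ f                                ≡⟨ ∏-remove {i = t} f ⟩
  f t ℚ.* ∏ (f ∘ punchIn t)          ≡⟨ cong₂ ℚ._*_ ft≡-gt
                                          (∏-cong λ s → f≡g (punchIn t s) (Fin.punchInᵢ≢i t s)) ⟩
  ℚ.- g t ℚ.* ∏ (g ∘ punchIn t)      ≡⟨ ℚ.neg-distribˡ-* (g t) _ ⟨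
  ℚ.- (g t ℚ.* ∏ (g ∘ punchIn t))    ≡⟨ cong ℚ.-_ (∏-remove {i = t} g) ⟨
  ℚ.- ∏ g                            ∎
  where open ≡-Reasoning

∏-one : ∀ {m} {f : Fin m → ℚ} → (∀ s → f s ≡ 1ℚ) → ∏ f ≡ 1ℚ
∏-one {zero}  f≡1 = refl
∏-one {suc m} f≡1 = cong₂ ℚ._*_ (f≡1 zero) (∏-one (f≡1 ∘ suc))

transpose-left : ∀ {n} (i j : Fin n) → PC.transpose i j i ≡ j
transpose-left i j rewrite dec-true (i Fin.≟ i) refl = refl

transpose-right : ∀ {n} (i j : Fin n) → PC.transpose i j j ≡ i
transpose-right i j with j Fin.≟ i
... | yes j≡i = j≡i
... | no  _ rewrite dec-true (j Fin.≟ j) refl = refl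

transpose-other : ∀ {n} {i j v : Fin n} → v ≢ i → v ≢ j → PC.transpose i j v ≡ v
transpose-other {i = i} {j} {v} v≢i v≢j
  rewrite dec-false (v Fin.≟ i) v≢i | dec-false (v Fin.≟ j) v≢j = refl

-- Action of vertex permutations on edges

Edge-≡ : ∀ {n k} {e f : Edge n k} → value e ≡ value f → e ≡ f
Edge-≡ refl = refl

lookup-image : ∀ {n} (π : Permutation′ n) S v → lookup (image π S) v ≡ lookup S (π ⟨$⟩ˡ v)
lookup-image π S v = Vec.lookup∘tabulate (λ y → lookup S (π ⟨$⟩ˡ y)) v

module _ {n k : ℕ} where

  imageᵉ-flip : ∀ (π : Permutation′ n) (e : Edge n k) → imageᵉ (Perm.flip π) (imageᵉ π e) ≡ e
  imageᵉ-flip π (S , _) = Edge-≡ (trans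
    (Vec.tabulate-cong λ y → trans (lookup-image π S (π ⟨$⟩ʳ y)) (cong (lookup S) (Perm.inverseˡ π)))
    (Vec.tabulate∘lookup S))

  -- Both lists are duplicate-free and contain every edge: `imageᵉ π` is injective, and each edge is
  -- the image of its preimage under `π`. Duplicate-free lists with the same members are
  -- rearrangements of each other.
  edges-image : ∀ (π : Permutation′ n) → map (imageᵉ π) (edges n k) ↭ edges n k
  edges-image π = ∼bag⇒↭ (unique∧set⇒bag
    (Unique.map⁺ injective (edges-unique n k))
    (edges-unique n k)
    λ {e} → mk⇔ (λ _ → ∈-edges e)
      (λ _ → subst (_∈ map (imageᵉ π) (edges n k)) (imageᵉ-flip (Perm.flip π) e)
        (∈-map⁺ (imageᵉ π) (∈-edges (imageᵉ (Perm.flip π) e)))))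
    where
    injective : ∀ {e f : Edge n k} → imageᵉ π e ≡ imageᵉ π f → e ≡ f
    injective {e} {f} eq =
      trans (sym (imageᵉ-flip π e)) (trans (cong (imageᵉ (Perm.flip π)) eq) (imageᵉ-flip π f))

  ∑ℚ-image : ∀ (π : Permutation′ n) f → ∑ℚ (edges n k) (f ∘ imageᵉ π) ≡ ∑ℚ (edges n k) f
  ∑ℚ-image π f = trans (sym (foldr-map (λ e s → f e ℚ.+ s) (imageᵉ π) 0ℚ (edges n k)))
    (∑ℚ-↭ f (edges-image π))

  -- Re-indexing by `π` shows that the sum equals its own negative. Every vanishing sum of
  -- polytabloids below comes down to this.
  ∑ℚ-antisymmetric : ∀ (π : Permutation′ n) f → (∀ e → f (imageᵉ π e) ≡ ℚ.- f e) →
                     ∑ℚ (edges n k) f ≡ 0ℚ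
  ∑ℚ-antisymmetric π f f-anti = p≡-p⇒p≡0 (trans (sym (∑ℚ-image π f))
    (trans (∑ℚ-cong (edges n k) f-anti) (∑ℚ-neg (edges n k) f)))

  -- Monomials, polytabloids and their orthogonality

  χ : Fin n → Edge n k → ℚ
  χ v e = if lookup (value e) v then 1ℚ else 0ℚ

  χ-image : ∀ π v e → χ v (imageᵉ π e) ≡ χ (π ⟨$⟩ˡ v) e
  χ-image π v (S , _) = cong (if_then 1ℚ else 0ℚ) (lookup-image π S v)

  monomial : ∀ {m} → (Fin m → Fin n) → Edge n k → ℚ
  monomial B e = ∏ λ s → χ (B s) e

  -- The rows of `c` hold the a_t and the b_t. For distinct entries this is the Specht polytabloid
  -- of shape (n-j, j), with each j-set replaced by the indicator that the edge contains it.
  polytabloid : ∀ {j} → (Fin 2 → Fin j → Fin n) → Edge n k → ℚ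
  polytabloid c e = ∏ λ t → χ (c zero t) e ℚ.- χ (c (suc zero) t) e

  polytabloid-image : ∀ {j} (c : Fin 2 → Fin j → Fin n) π e →
    polytabloid c (imageᵉ π e) ≡ polytabloid (λ p t → π ⟨$⟩ˡ c p t) e
  polytabloid-image c π e = ∏-cong λ t →
    cong₂ ℚ._-_ (χ-image π (c zero t) e) (χ-image π (c (suc zero) t) e)

  module _ {j} (c : Fin 2 → Fin j → Fin n)
    (c-injective : ∀ {p q s t} → c p s ≡ c q t → p ≡ q × s ≡ t) where

    swap : Fin j → Permutation′ n
    swap t = Perm.transpose (c zero t) (c (suc zero) t)

    -- The swap reverses the factor at `t`; since the entries of `c` are distinct, it moves no
    -- vertex of another pair.
    polytabloid-swap : ∀ t e → polytabloid c (imageᵉ (swap t) e) ≡ ℚ.- polytabloid c e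
    polytabloid-swap t e = trans (polytabloid-image c (swap t) e)
      (∏-negate _ _ t
        -- `χ-image` uses the inverse permutation, and the inverse of `transpose i j` is
        -- `transpose j i`: hence the reversed arguments.
        (trans (cong₂ (λ u v → χ u e ℚ.- χ v e) (transpose-right (c (suc zero) t) (c zero t))
                 (transpose-left (c (suc zero) t) (c zero t)))
          (solve 2 (λ x y → x :- y := :- (y :- x)) refl (χ (c (suc zero) t) e) (χ (c zero t) e)))
        λ s s≢t → cong₂ (λ u v → χ u e ℚ.- χ v e)
          (transpose-other (s≢t ∘ proj₂ ∘ c-injective) (s≢t ∘ proj₂ ∘ c-injective))
          (transpose-other (s≢t ∘ proj₂ ∘ c-injective) (s≢t ∘ proj₂ ∘ c-injective)))
      where open +-*-Solver

    -- Pigeonhole: if every pair were hit, some index of `B` would serve two pairs, yet the pairs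
    -- are disjoint.
    missed-pair : ∀ {m} → m ℕ.< j → (B : Fin m → Fin n) → ∃[ t ] (∀ p s → B s ≢ c p t)
    missed-pair m<j B =
      -- Being hit is decidable by finite search, so refuting "all are hit" yields an explicit `t`.
      let t , ¬hit = Fin.¬∀⟶∃¬ _ (λ t → ∃ λ p → ∃ λ s → B s ≡ c p t)
            (λ t → Fin.any? λ p → Fin.any? λ s → B s Fin.≟ c p t) not-all
      in t , λ p s eq → ¬hit (p , s , eq)
      where
      not-all : ¬ (∀ t → ∃ λ p → ∃ λ s → B s ≡ c p t)
      not-all hit with t , u , t<u , eq ← Fin.pigeonhole m<j (λ t → proj₁ (proj₂ (hit t))) =
        Fin.<⇒≢ t<u (proj₂ (c-injective (trans (sym (proj₂ (proj₂ (hit t))))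
          (trans (cong B eq) (proj₂ (proj₂ (hit u)))))))

    -- For a pair `t` that `B` misses, the product is antisymmetric under `swap t`.
    monomial⊥polytabloid : ∀ {m} → m ℕ.< j → (B : Fin m → Fin n) →
      ∑ℚ (edges n k) (λ e → monomial B e ℚ.* polytabloid c e) ≡ 0ℚ
    monomial⊥polytabloid m<j B with t , B∌ ← missed-pair m<j B =
      ∑ℚ-antisymmetric (swap t) _ λ e → trans
        (cong₂ ℚ._*_
          (∏-cong λ s → trans (χ-image (swap t) (B s) e)
            (cong (λ v → χ v e) (transpose-other (B∌ (suc zero) s) (B∌ zero s))))
          (polytabloid-swap t e))
        (sym (ℚ.neg-distribʳ-* (monomial B e) (polytabloid c e)))

    -- Induction on `i`, with the monomial as accumulator: split the first factor of `polytabloid d`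
    -- and absorb each of its two terms into the monomial. The total `i + m` is preserved, so the
    -- bound reads `m < j` once `d` is exhausted.
    monomial*polytabloid⊥polytabloid : ∀ {m} i → i ℕ.+ m ℕ.< j →
      (B : Fin m → Fin n) (d : Fin 2 → Fin i → Fin n) →
      ∑ℚ (edges n k) (λ e → monomial B e ℚ.* polytabloid d e ℚ.* polytabloid c e) ≡ 0ℚ
    monomial*polytabloid⊥polytabloid zero m<j B d = trans
      (∑ℚ-cong (edges n k) λ e → cong (ℚ._* polytabloid c e) (ℚ.*-identityʳ (monomial B e)))
      (monomial⊥polytabloid m<j B)
    monomial*polytabloid⊥polytabloid {m} (suc i) i+m<j B d = begin
      ∑ℚ (edges n k) (λ e → monomial B e ℚ.* polytabloid d e ℚ.* polytabloid c e)
        ≡⟨ ∑ℚ-cong (edges n k) (λ e →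
             solve 5 (λ b x y p q → b :* ((x :- y) :* p) :* q := x :* b :* p :* q :- y :* b :* p :* q)
               refl (monomial B e) (χ (d zero zero) e) (χ (d (suc zero) zero) e)
               (polytabloid d′ e) (polytabloid c e)) ⟩
      ∑ℚ (edges n k) (λ e → F zero e ℚ.- F (suc zero) e)
        ≡⟨ ∑ℚ-- (edges n k) (F zero) (F (suc zero)) ⟩
      ∑ℚ (edges n k) (F zero) ℚ.- ∑ℚ (edges n k) (F (suc zero))
        ≡⟨ cong₂ ℚ._-_ (F⊥ zero) (F⊥ (suc zero)) ⟩
      0ℚ ∎
      where
      open ≡-Reasoning
      open +-*-Solver
      d′ : Fin 2 → Fin i → Fin n
      d′ p = d p ∘ suc
      F : Fin 2 → Edge n k → ℚ
      F p e = monomial (d p zero VecF.∷ B) e ℚ.* polytabloid d′ e ℚ.* polytabloid c e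
      F⊥ : ∀ p → ∑ℚ (edges n k) (F p) ≡ 0ℚ
      F⊥ p = monomial*polytabloid⊥polytabloid i (subst (ℕ._< j) (sym (ℕ.+-suc i m)) i+m<j)
        (d p zero VecF.∷ B) d′

    polytabloid⊥polytabloid : ∀ {i} → i ℕ.< j → (d : Fin 2 → Fin i → Fin n) →
      ∑ℚ (edges n k) (λ e → polytabloid d e ℚ.* polytabloid c e) ≡ 0ℚ
    polytabloid⊥polytabloid {i} i<j d = trans
      (∑ℚ-cong (edges n k) λ e →
        cong (ℚ._* polytabloid c e) (sym (ℚ.*-identityˡ (polytabloid d e))))
      -- `λ ()` is the empty family, whose monomial is the constant `1ℚ`.
      (monomial*polytabloid⊥polytabloid i (subst (ℕ._< j) (sym (ℕ.+-identityʳ i)) i<j) (λ ()) d)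

    -- The total is the pairing with the empty monomial.
    ∑ℚ-polytabloid : 0 ℕ.< j → ∑ℚ (edges n k) (polytabloid c) ≡ 0ℚ
    ∑ℚ-polytabloid 0<j = trans
      (∑ℚ-cong (edges n k) λ e → sym (ℚ.*-identityˡ (polytabloid c e)))
      (monomial⊥polytabloid 0<j (λ ()))

  seq-weight-⊤ : ∀ (w : WeightedHypergraph n k) m →
    seq (weight w ⊤) m ≡ ∑ℚ (edges n k) (λ e → seq (w e) m)
  seq-weight-⊤ w m = trans
    (cong (λ es → seq (∑ es w) m)
      (filter-all (λ e → value e ⊆? ⊤) (All.universal (λ e {v} → ⊆⊤ {p = value e} {v}) (edges n k))))
    (seq-∑ (edges n k) w m)

-- Supplies an edge on which polytabloids can be evaluated. Membership is stated with `<ᵇ`, the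
-- Boolean behind `<?`, so `dec-true` and `dec-false` settle it.
prefix : ∀ k n → k ≤ n → Σ[ e ∈ Edge n k ] (∀ v → lookup (value e) v ≡ (toℕ v ℕ.<ᵇ k))
prefix zero    n       _   = (⊥ , [ ∣⊥∣≡0 n ]) , λ v → Vec.lookup-replicate v outside
prefix (suc k) (suc n) k≤n with e , e-lookup ← prefix k n (s≤s⁻¹ k≤n) =
  cons-in e , λ { zero → refl ; (suc v) → e-lookup v }

-- Vanishing of the discrepancy

maxₚ-0 : ∀ {n} (f : Permutation′ n → ℝ) m → (∀ π → seq (f π) m ≡ 0ℚ) → seq (maxₚ f) m ≡ 0ℚ
maxₚ-0 {n} f m f≡0 = go (permutations n)
  where
  go : ∀ πs → seq (foldr (λ π x → f π Defs.⊔ x) (f Perm.id) πs) m ≡ 0ℚ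
  go []       = f≡0 Perm.id
  go (π ∷ πs) = cong₂ ℚ._⊔_ (f≡0 π) (go πs)

minₚ-0 : ∀ {n} (f : Permutation′ n → ℝ) m → (∀ π → seq (f π) m ≡ 0ℚ) → seq (minₚ f) m ≡ 0ℚ
minₚ-0 {n} f m f≡0 = go (permutations n)
  where
  go : ∀ πs → seq (foldr (λ π x → f π Defs.⊓ x) (f Perm.id) πs) m ≡ 0ℚ
  go []       = f≡0 Perm.id
  go (π ∷ πs) = cong₂ ℚ._⊓_ (f≡0 π) (go πs)

-- The mean term contains the factor d(w) = 0, and the maximum and minimum range over values that
-- are all zero.
disc-0 : ∀ {n k} .{{_ : NonZero (n C k)}} (w u : WeightedHypergraph n k) m →
  seq (weight w ⊤) m ≡ 0ℚ → (∀ π → seq ⟨ permute π w , u ⟩ m ≡ 0ℚ) → seq (disc w u) m ≡ 0ℚ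
disc-0 {n} {k} w u m w≡0 ⟨⟩≡0 = combine-zeros
  (maxₚ-0 (λ π → ⟨ permute π w , u ⟩) m ⟨⟩≡0)
  (product-zero (+ 1 ℚ./ (n C k)) (seq (density u) m) (+ (n C k) ℚ./ 1) w≡0)
  (minₚ-0 (λ π → ⟨ permute π w , u ⟩) m ⟨⟩≡0)
  where
  product-zero : ∀ {p} q r s → p ≡ 0ℚ → p ℚ.* q ℚ.* r ℚ.* s ≡ 0ℚ
  product-zero q r s refl =
    trans (cong (λ x → x ℚ.* r ℚ.* s) (ℚ.*-zeroˡ q))
      (trans (cong (ℚ._* s) (ℚ.*-zeroˡ r)) (ℚ.*-zeroˡ s))
  combine-zeros : ∀ {p q r} → p ≡ 0ℚ → q ≡ 0ℚ → r ≡ 0ℚ →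
    (p ℚ.- q) ℚ.⊔ (q ℚ.- r) ≡ 0ℚ
  combine-zeros refl refl refl = refl

-- The normalised polytabloids

module Construction (k n : ℕ) (2k≤n : 2 * k ≤ n) where

  -- `combine` lays out two blocks of length `k`: a_t is vertex t and b_t is vertex k + t. The first
  -- `k` vertices thus contain every a_t and no b_t.
  vertex : Fin 2 → Fin k → Fin n
  vertex p t = inject≤ (combine p t) 2k≤n

  vertex-injective : ∀ {p q s t} → vertex p s ≡ vertex q t → p ≡ q × s ≡ t
  vertex-injective eq = Fin.combine-injective _ _ _ _ (Fin.inject≤-injective 2k≤n 2k≤n _ _ eq)

  toℕ-vertex : ∀ p t → toℕ (vertex p t) ≡ k * toℕ p ℕ.+ toℕ t
  toℕ-vertex p t = trans (Fin.toℕ-inject≤ _ 2k≤n) (Fin.toℕ-combine p t)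

  -- Indices start at zero, so `i` receives `suc (toℕ i)` pairs: at least one, which forces total
  -- zero, and at most `k`, which fits into `vertex`.
  pairs : (i : Fin k) → Fin 2 → Fin (suc (toℕ i)) → Fin n
  pairs i p t = vertex p (inject≤ t (Fin.toℕ<n i))

  pairs-injective : ∀ i {p q s t} → pairs i p s ≡ pairs i q t → p ≡ q × s ≡ t
  pairs-injective i eq with p≡q , s≡t ← vertex-injective eq =
    p≡q , Fin.inject≤-injective _ _ _ _ s≡t

  U : Fin k → Edge n k → ℚ
  U i = polytabloid (pairs i)

  witness : Edge n k
  witness = proj₁ (prefix k n (≤-trans (m≤m+n k _) 2k≤n))

  lookup-witness : ∀ v → lookup (value witness) v ≡ (toℕ v ℕ.<ᵇ k)
  lookup-witness = proj₂ (prefix k n (≤-trans (m≤m+n k _) 2k≤n))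

  χ-witness-0 : ∀ t → χ (vertex zero t) witness ≡ 1ℚ
  χ-witness-0 t = cong (if_then 1ℚ else 0ℚ) (trans (lookup-witness (vertex zero t))
    (dec-true (toℕ (vertex zero t) ℕ.<? k) (subst (ℕ._< k)
      (sym (trans (toℕ-vertex zero t) (cong (ℕ._+ toℕ t) (ℕ.*-zeroʳ k)))) (Fin.toℕ<n t))))

  χ-witness-1 : ∀ t → χ (vertex (suc zero) t) witness ≡ 0ℚ
  χ-witness-1 t = cong (if_then 1ℚ else 0ℚ) (trans (lookup-witness (vertex (suc zero) t))
    (dec-false (toℕ (vertex (suc zero) t) ℕ.<? k) (ℕ.≤⇒≯ (subst (k ℕ.≤_)
      (sym (trans (toℕ-vertex (suc zero) t) (cong (ℕ._+ toℕ t) (ℕ.*-identityʳ k))))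
      (m≤m+n k (toℕ t))))))

  U-witness : ∀ i → U i witness ≡ 1ℚ
  U-witness i = ∏-one λ t → cong₂ ℚ._-_ (χ-witness-0 (inject≤ t (Fin.toℕ<n i)))
    (χ-witness-1 (inject≤ t (Fin.toℕ<n i)))

  norm : Fin k → ℚ
  norm i = ∑ℚ (edges n k) (ℚ.∣_∣ ∘ U i)

  -- The witness edge alone contributes `1`, as every factor of `U i` there is 1 - 0.
  norm-positive : ∀ i → ℚ.Positive (norm i)
  norm-positive i = ℚ.positive (ℚ.<-≤-trans (ℚ.positive⁻¹ 1ℚ)
    (subst (ℚ._≤ norm i) (cong ℚ.∣_∣ (U-witness i))
      (∈⇒≤∑ℚ (ℚ.0≤∣p∣ ∘ U i) (∈-edges witness))))

  instance
    norm-nonZero : ∀ {i} → ℚ.NonZero (norm i)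
    norm-nonZero {i} = ℚ.pos⇒nonZero (norm i) {{norm-positive i}}

  scale : Fin k → ℚ
  scale i = + (n C k) ℚ./ 1 ℚ.* ℚ.1/ norm i

  w : Fin k → WeightedHypergraph n k
  w i e = fromℚ (U i e ℚ.* scale i)

  0≤scale : ∀ i → 0ℚ ℚ.≤ scale i
  0≤scale i = ℚ.nonNegative⁻¹ (scale i) {{ℚ.nonNeg*nonNeg⇒nonNeg (+ (n C k) ℚ./ 1)
    {{ℚ.normalize-nonNeg (n C k) 1}} (ℚ.1/ norm i)
    {{ℚ.pos⇒nonNeg (ℚ.1/ norm i) {{ℚ.1/pos⇒pos (norm i) {{norm-positive i}}}}}}}}

  w-total : ∀ i m → seq (weight (w i) ⊤) m ≡ 0ℚ
  w-total i m = begin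
    seq (weight (w i) ⊤) m                      ≡⟨ seq-weight-⊤ (w i) m ⟩
    ∑ℚ (edges n k) (λ e → U i e ℚ.* scale i)    ≡⟨ ∑ℚ-*ʳ (edges n k) (U i) (scale i) ⟩
    ∑ℚ (edges n k) (U i) ℚ.* scale i            ≡⟨ cong (ℚ._* scale i)
                                                     (∑ℚ-polytabloid (pairs i) (pairs-injective i)
                                                       (s≤s z≤n)) ⟩
    0ℚ ℚ.* scale i                              ≡⟨ ℚ.*-zeroˡ (scale i) ⟩
    0ℚ                                          ∎
    where open ≡-Reasoning

  w-norm : ∀ i m → seq ‖ w i ‖₁ m ≡ + (n C k) ℚ./ 1
  w-norm i m = begin
    seq ‖ w i ‖₁ m
      ≡⟨ seq-∑ (edges n k) (abs ∘ w i) m ⟩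
    ∑ℚ (edges n k) (λ e → ℚ.∣ U i e ℚ.* scale i ∣)
      ≡⟨ ∑ℚ-cong (edges n k) (λ e → trans (ℚ.∣p*q∣≡∣p∣*∣q∣ (U i e) (scale i))
           (cong (ℚ.∣ U i e ∣ ℚ.*_) (ℚ.0≤p⇒∣p∣≡p (0≤scale i)))) ⟩
    ∑ℚ (edges n k) (λ e → ℚ.∣ U i e ∣ ℚ.* scale i)
      ≡⟨ ∑ℚ-*ʳ (edges n k) (ℚ.∣_∣ ∘ U i) (scale i) ⟩
    norm i ℚ.* (+ (n C k) ℚ./ 1 ℚ.* ℚ.1/ norm i)
      ≡⟨ solve 3 (λ N C r → N :* (C :* r) := C :* (N :* r)) refl (norm i) (+ (n C k) ℚ./ 1)
           (ℚ.1/ norm i) ⟩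
    + (n C k) ℚ./ 1 ℚ.* (norm i ℚ.* ℚ.1/ norm i)
      ≡⟨ cong (+ (n C k) ℚ./ 1 ℚ.*_) (ℚ.*-inverseʳ (norm i)) ⟩
    + (n C k) ℚ./ 1 ℚ.* 1ℚ
      ≡⟨ ℚ.*-identityʳ _ ⟩
    + (n C k) ℚ./ 1 ∎
    where
    open ≡-Reasoning
    open +-*-Solver

  -- Permuting `U i` gives the polytabloid of the moved pairs, which still has fewer pairs than
  -- `U j`; the scalars factor out.
  w-orthogonal : ∀ {i j} → i < j → ∀ π m → seq ⟨ permute π (w i) , w j ⟩ m ≡ 0ℚ
  w-orthogonal {i} {j} i<j π m = begin
    seq ⟨ permute π (w i) , w j ⟩ m
      ≡⟨ seq-∑ (edges n k) (λ e → permute π (w i) e Defs.* w j e) m ⟩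
    ∑ℚ (edges n k) (λ e → U i (imageᵉ (Perm.flip π) e) ℚ.* scale i ℚ.* (U j e ℚ.* scale j))
      ≡⟨ ∑ℚ-cong (edges n k) (λ e → trans
           (cong (λ x → x ℚ.* scale i ℚ.* (U j e ℚ.* scale j))
             (polytabloid-image (pairs i) (Perm.flip π) e))
           (solve 4 (λ x r y s → x :* r :* (y :* s) := x :* y :* (r :* s)) refl
             (polytabloid πpairs e) (scale i) (U j e) (scale j))) ⟩
    ∑ℚ (edges n k) (λ e → polytabloid πpairs e ℚ.* U j e ℚ.* (scale i ℚ.* scale j))
      ≡⟨ ∑ℚ-*ʳ (edges n k) (λ e → polytabloid πpairs e ℚ.* U j e) (scale i ℚ.* scale j) ⟩
    ∑ℚ (edges n k) (λ e → polytabloid πpairs e ℚ.* U j e) ℚ.* (scale i ℚ.* scale j)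
      ≡⟨ cong (ℚ._* (scale i ℚ.* scale j))
           (polytabloid⊥polytabloid (pairs j) (pairs-injective j) (s≤s i<j) πpairs) ⟩
    0ℚ ℚ.* (scale i ℚ.* scale j)
      ≡⟨ ℚ.*-zeroˡ (scale i ℚ.* scale j) ⟩
    0ℚ ∎
    where
    open ≡-Reasoning
    open +-*-Solver
    -- `permute π` pulls back along `flip π` and `polytabloid-image` inverts once more, so the pairs
    -- move by `π` itself.
    πpairs : Fin 2 → Fin (suc (toℕ i)) → Fin n
    πpairs p t = π ⟨$⟩ʳ pairs i p t

theorem1p1 : (k : ℕ) → 2 ≤ k →
    (n : ℕ) → (2k≤n : 2 * k ≤ n) →
    Σ[ w ∈ (Fin k → WeightedHypergraph n k) ]
    ((i : Fin k) → weight (w i) ⊤ ≃ 0ℝ × ‖ w i ‖₁ ≃ fromℕ (n C k))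
    × ((i j : Fin k) → i < j →
    disc {{nCk-nonZero (≤-trans (m≤m+n k _) 2k≤n)}} (w i) (w j) ≃ 0ℝ)
theorem1p1 k _ n 2k≤n = w
  , (λ i → ≗⇒≃ (weight (w i) ⊤) 0ℝ (w-total i) , ≗⇒≃ ‖ w i ‖₁ (fromℕ (n C k)) (w-norm i))
  , λ i j i<j → ≗⇒≃ (disc (w i) (w j)) 0ℝ λ m →
      disc-0 (w i) (w j) m (w-total i m) λ π → w-orthogonal i<j π m
  where
  open Construction k n 2k≤n
  -- Lets instance search fill in the proof that the statement passes to `disc` explicitly.
  instance
    nCk≢0 : NonZero (n C k)
    nCk≢0 = nCk-nonZero (≤-trans (m≤m+n k _) 2k≤n)
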